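{- Let $P(q)=P_1(q)P_2(q)\cdots P_k(q)$ be a product of $q$-binomial coefficients $P_i(q)=\binom{m_i+n_i}{m_i,n_i}_q$, with $m_i,n_i\ge1$. Then there exists a rooted tree $T$ with $Q(T)=P(q)$ if and only if the numerator of $P(q)$ (in reduced form) does not repeat any $q$-integer.
   Context: Notation: $[k]_q=1+q+\dots+q^{k-1}$, $[k]_q!=[k]_q\cdots[1]_q$, $\binom{m+n}{m,n}_q=\frac{[m+n]_q!}{[m]_q!\,[n]_q!}$. A polynomial written as $P(q)=\frac{[a_1]_q\cdots[a_s]_q}{[b_1]_q\cdots[b_l]_q}$ (with all $a_i,b_j\ge 2$, since $[1]_q=1$) is in reduced form if $a_i\ne b_j$ for all $i,j$; the reduced form is unique. The numerator $N(P(q))$ is the (formal) product $[a_1]_q\cdots[a_s]_q$ of the reduced form; it does not repeat any $q$-integer if $a_1,\dots,a_s$ are pairwise distinct. Plucking polynomial: trees are finite and grow up from the root. For a plane rooted tree $T$, $Q(T,q)=1$ if $T$ is a single vertex; otherwise $Q(T,q)=\sum_{v}q^{r(T,v)}Q(T-v,q)$, the sum over all leaves $v$ (vertices of degree $1$ other than the root), where $r(T,v)$ is the number of edges of $T$ to the right of the unique path joining $v$ to the root. It is known that $Q(T)$ does not depend on the plane embedding, so it is an invariant of rooted trees. -}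

module Defs where

open import Data.Nat.Base as ℕ using (ℕ; zero; suc)
open import Data.Nat.Properties using (suc-injective; +-suc)
open import Data.Integer.Base as ℤ using (ℤ; 0ℤ; 1ℤ)
open import Data.List.Base using (List; []; _∷_; _++_; map; foldr; replicate)
open import Data.List.Properties using (map-cong)
open import Data.List.Relation.Unary.All using (All)
open import Data.List.Relation.Unary.Unique.Propositional using (Unique)
open import Data.List.Relation.Binary.Disjoint.Propositional using (Disjoint)
open import Data.Product using (∃₂; _×_)
open import Relation.Binary.PropositionalEquality
  using (_≡_; refl; cong)

-- Coefficient lists, constant term first.  Trailing zeros are allowed, so
-- equality of polynomials is _≈_ and not _≡_.
Poly : Set
Poly = List ℤ

coeff : Poly → ℕ → ℤ
coeff []      _       = 0ℤ
coeff (a ∷ p) zero    = a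
coeff (a ∷ p) (suc i) = coeff p i

infix 4 _≈_
_≈_ : Poly → Poly → Set
p ≈ r = ∀ i → coeff p i ≡ coeff r i

infixl 6 _+_
_+_ : Poly → Poly → Poly
[]      + r       = r
(a ∷ p) + []      = a ∷ p
(a ∷ p) + (b ∷ r) = (a ℤ.+ b) ∷ (p + r)

infixl 7 _*_
_*_ : Poly → Poly → Poly
[]      * r = []
(a ∷ p) * r = map (a ℤ.*_) r + (0ℤ ∷ (p * r))

sum : List Poly → Poly
sum = foldr _+_ []

product : List Poly → Poly
product = foldr _*_ (1ℤ ∷ [])

q^_ : ℕ → Poly
q^ r = replicate r 0ℤ ++ (1ℤ ∷ [])

[_]q : ℕ → Poly
[ k ]q = replicate k 1ℤ

[_]q! : ℕ → Poly
[ zero  ]q! = 1ℤ ∷ []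
[ suc k ]q! = [ suc k ]q * [ k ]q!

-- P = A / B.  In ℤ[q] this determines P uniquely as soon as B is not the
-- zero polynomial, which is the case in both uses below.
_IsQuotient_Over_ : Poly → Poly → Poly → Set
P IsQuotient A Over B = P * B ≈ A

IsQBinomial : ℕ → ℕ → Poly → Set
IsQBinomial m n P = P IsQuotient [ m ℕ.+ n ]q! Over ([ m ]q! * [ n ]q!)

record IsReducedForm (P : Poly) (as bs : List ℕ) : Set where
  field
    as≥2     : All (2 ℕ.≤_) as
    bs≥2     : All (2 ℕ.≤_) bs
    quotient : P IsQuotient product (map [_]q as) Over product (map [_]q bs)
    disjoint : Disjoint as bs

-- The reduced form is unique up to reordering as and bs, and Unique is
-- insensitive to reordering, so quantifying existentially over the reduced
-- form speaks about *the* numerator of P.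
NumeratorDoesNotRepeat : Poly → Set
NumeratorDoesNotRepeat P = ∃₂ λ as bs → IsReducedForm P as bs × Unique as

-- A vertex together with the subtrees growing from it, from left to right.
data Tree : Set where
  node : List Tree → Tree

-- The functions on List Tree below regard a list ts as the tree node ts,
-- i.e. as the subtrees attached, by one edge each, to a common root.

edges′ : List Tree → ℕ
edges′ []             = 0
edges′ (node us ∷ ts) = suc (edges′ us) ℕ.+ edges′ ts

edges : Tree → ℕ
edges (node ts) = edges′ ts

-- The leaves of node ts; the root is never one of them.
data Leaf′ : List Tree → Set where
  here  : ∀ {ts}    → Leaf′ (node [] ∷ ts)
  below : ∀ {us ts} → Leaf′ us → Leaf′ (node us ∷ ts)
  next  : ∀ {t ts}  → Leaf′ ts → Leaf′ (t ∷ ts)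

Leaf : Tree → Set
Leaf (node ts) = Leaf′ ts

leaves′ : ∀ ts → List (Leaf′ ts)
leaves′ []                   = []
leaves′ (node []       ∷ ts) = here ∷ map next (leaves′ ts)
leaves′ (node (u ∷ us) ∷ ts) = map below (leaves′ (u ∷ us)) ++ map next (leaves′ ts)

leaves : ∀ T → List (Leaf T)
leaves (node ts) = leaves′ ts

remove′ : ∀ {ts} → Leaf′ ts → List Tree
remove′ (here {ts})         = ts
remove′ (below {ts = ts} v) = node (remove′ v) ∷ ts
remove′ (next {t} v)        = t ∷ remove′ v

remove : ∀ T → Leaf T → Tree
remove (node ts) v = node (remove′ v)

-- r(T,v): the number of edges to the right of the path from v to the root.
right′ : ∀ {ts} → Leaf′ ts → ℕ
right′ (here {ts})         = edges′ ts
right′ (below {ts = ts} v) = right′ v ℕ.+ edges′ ts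
right′ (next v)            = right′ v

right : ∀ T → Leaf T → ℕ
right (node ts) v = right′ v

-- The recursion for Q is made structural by recursing on the number of edges:
-- edges T = 0 exactly when T is a single vertex, and removing a leaf removes
-- exactly one edge.  Q-vertex and Q-step state the resulting recursion.
pluck : ℕ → Tree → Poly
pluck zero    T = 1ℤ ∷ []
pluck (suc e) T = sum (map (λ v → (q^ right T v) * pluck e (remove T v)) (leaves T))

Q : Tree → Poly
Q T = pluck (edges T) T

edges-remove : ∀ {ts} (v : Leaf′ ts) → edges′ ts ≡ suc (edges′ (remove′ v))
edges-remove here                = refl
edges-remove (below {ts = ts} v) = cong (λ e → suc e ℕ.+ edges′ ts) (edges-remove v)
edges-remove (next {node us} {ts} v)
  rewrite edges-remove v = cong suc (+-suc (edges′ us) (edges′ (remove′ v)))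

Q-vertex : Q (node []) ≡ 1ℤ ∷ []
Q-vertex = refl

Q-step : ∀ t ts → let T = node (t ∷ ts) in
         Q T ≡ sum (map (λ v → (q^ right T v) * Q (remove T v)) (leaves T))
Q-step (node us) ts = cong sum (map-cong
  (λ v → cong (λ e → (q^ right T v) * pluck e (remove T v))
              (suc-injective (edges-remove v)))
  (leaves T))
  where T = node (node us ∷ ts)

{-# OPTIONS --safe #-}
module Submission where

-- By induction on the number of edges, Q(T) = [n]_q! / ∏ [h_v]_q, where n is the number of
-- edges of T and h_v, for v not the root, the number of vertices of the subtree growing from v.
-- So the numerator of Q(T) is part of [n]_q! and repeats nothing.
--
-- Conversely, replacing a pendant path with m + n + k edges by a path with k edges that carries
-- paths with m and n edges at its end multiplies Q by the q-binomial coefficient of (m, n).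
-- Realise the given coefficients in this way, by decreasing m + n, starting from one long path.
-- If at some stage no path with at least N = m + n edges is left, then [N]_q occurs in the
-- factorials [m_i + n_i]_q! at least two times more than in the [m_i]_q! and [n_i]_q!, so the
-- numerator repeats [N]_q.  This uses that a product of q-integers determines its factors:
-- clear powers of 1 − q and look at the lowest nonconstant term of ∏ (1 − q^a).

open import Defs
open import Algebra.Bundles using (CommutativeMonoid; CommutativeRing)
import Algebra.Properties.CommutativeSemigroup as CommutativeSemigroupProperties
import Algebra.Properties.Group as GroupProperties
import Algebra.Properties.Ring as RingProperties
open import Data.Fin.Base as Fin using (Fin)
open import Data.Integer.Base as ℤ using (ℤ; 0ℤ; 1ℤ)
import Data.Integer.Properties as ℤₚ
open import Data.List.Base
  using (List; []; _∷_; _++_; map; replicate; tabulate; length; filter; concatMap; applyDownFrom)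
open import Data.List.Extrema.Nat using (max; xs≤max)
open import Data.List.Membership.Propositional using (_∈_; find)
open import Data.List.Membership.Propositional.Properties using (∈-∃++)
open import Data.List.Properties
  using (map-++; map-∘; ++-assoc; length-++; filter-++; filter-some; filter-none;
         filter-accept; filter-reject)
open import Data.List.Relation.Binary.Disjoint.Propositional using (Disjoint)
open import Data.List.Relation.Binary.Permutation.Propositional
open import Data.List.Relation.Binary.Permutation.Propositional.Properties
  using (map⁺; ++⁺; ++⁺ʳ; ++-comm; shift; shifts; filter-↭; ↭-length; ∈-resp-↭; All-resp-↭;
         ↭-map-inv)
open import Data.List.Relation.Binary.Permutation.Setoid.Properties using (foldr-commMonoid)
open import Data.List.Relation.Binary.Sublist.Propositional using (_⊆_; []; _∷_; _∷ʳ_)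
open import Data.List.Relation.Binary.Sublist.Propositional.Properties using (All-resp-⊆)
open import Data.List.Relation.Unary.All as All using (All; []; _∷_)
import Data.List.Relation.Unary.All.Properties as Allₚ
open import Data.List.Relation.Unary.AllPairs using ([]; _∷_)
open import Data.List.Relation.Unary.Any using (Any; here; there)
import Data.List.Relation.Unary.Any.Properties as Anyₚ
open import Data.List.Relation.Unary.Unique.Propositional using (Unique)
import Data.List.Relation.Unary.Unique.Propositional.Properties as Uniqueₚ
open import Data.Nat.Base as ℕ using (ℕ; zero; suc; _≤_; _<_; z≤n; s≤s; _∸_)
open import Data.Nat.Properties as ℕₚ using (_≟_; _≤?_)
open import Data.List.Membership.DecPropositional _≟_ using (_∈?_)
open import Data.Product using (∃; _×_; _,_; proj₁; proj₂; uncurry)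
open import Data.Sum.Base using (inj₁; inj₂)
open import Function.Base using (_∘_; case_of_)
open import Function.Bundles using (_⇔_; mk⇔)
open import Level using (0ℓ)
open import Relation.Binary.PropositionalEquality as ≡ using (_≡_; refl; cong; cong₂)
import Relation.Binary.Reasoning.Setoid as SetoidReasoning
open import Relation.Nullary using (yes; no; contradiction)

-- The ring of polynomials

-- Unlike the function type p ≈ r, this record type lets p and r be inferred from a proof.
infix 4 _≋_
record _≋_ (p r : Poly) : Set where
  constructor coeffwise
  field at : p ≈ r
open _≋_

1# : Poly
1# = 1ℤ ∷ []

-_ : Poly → Poly
- p = map ℤ.-_ p

scale : ℤ → Poly → Poly
scale a = map (a ℤ.*_)

coeff-+ : ∀ p r i → coeff (p + r) i ≡ coeff p i ℤ.+ coeff r i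
coeff-+ []      r       i       = ≡.sym (ℤₚ.+-identityˡ _)
coeff-+ (a ∷ p) []      i       = ≡.sym (ℤₚ.+-identityʳ _)
coeff-+ (a ∷ p) (b ∷ r) zero    = refl
coeff-+ (a ∷ p) (b ∷ r) (suc i) = coeff-+ p r i

coeff-- : ∀ p i → coeff (- p) i ≡ ℤ.- coeff p i
coeff-- []      i       = refl
coeff-- (a ∷ p) zero    = refl
coeff-- (a ∷ p) (suc i) = coeff-- p i

coeff-scale : ∀ a p i → coeff (scale a p) i ≡ a ℤ.* coeff p i
coeff-scale a []      i       = ≡.sym (ℤₚ.*-zeroʳ a)
coeff-scale a (b ∷ p) zero    = refl
coeff-scale a (b ∷ p) (suc i) = coeff-scale a p i

private variable
  a b : ℤ
  p p′ r r′ s : Poly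
  ks ls : List ℕ

≋-refl : p ≋ p
≋-refl .at i = refl

≋-sym : p ≋ r → r ≋ p
≋-sym e .at i = ≡.sym (e .at i)

≋-trans : p ≋ r → r ≋ r′ → p ≋ r′
≋-trans e f .at i = ≡.trans (e .at i) (f .at i)

∷-cong : a ≡ b → p ≋ r → a ∷ p ≋ b ∷ r
∷-cong e f .at zero    = e
∷-cong e f .at (suc i) = f .at i

tail-≋ : a ∷ p ≋ b ∷ r → p ≋ r
tail-≋ e .at i = e .at (suc i)

0∷[] : 0ℤ ∷ [] ≋ []
0∷[] .at zero    = refl
0∷[] .at (suc i) = refl

+-cong : p ≋ p′ → r ≋ r′ → p + r ≋ p′ + r′
+-cong {p} {p′} {r} {r′} e f .at i
  rewrite coeff-+ p r i | coeff-+ p′ r′ i = cong₂ ℤ._+_ (e .at i) (f .at i)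

+-assoc : ∀ p r s → (p + r) + s ≋ p + (r + s)
+-assoc p r s .at i
  rewrite coeff-+ (p + r) s i | coeff-+ p r i | coeff-+ p (r + s) i | coeff-+ r s i
  = ℤₚ.+-assoc (coeff p i) (coeff r i) (coeff s i)

+-comm : ∀ p r → p + r ≋ r + p
+-comm p r .at i rewrite coeff-+ p r i | coeff-+ r p i = ℤₚ.+-comm (coeff p i) (coeff r i)

+-identityˡ : ∀ p → [] + p ≋ p
+-identityˡ p = ≋-refl

+-identityʳ : ∀ p → p + [] ≋ p
+-identityʳ p = +-comm p []

-‿cong : p ≋ r → - p ≋ - r
-‿cong {p} {r} e .at i rewrite coeff-- p i | coeff-- r i = cong ℤ.-_ (e .at i)

-‿inverseˡ : ∀ p → - p + p ≋ []
-‿inverseˡ p .at i rewrite coeff-+ (- p) p i | coeff-- p i = ℤₚ.+-inverseˡ (coeff p i)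

-‿inverseʳ : ∀ p → p + - p ≋ []
-‿inverseʳ p = ≋-trans (+-comm p (- p)) (-‿inverseˡ p)

+-commutativeMonoid : CommutativeMonoid 0ℓ 0ℓ
+-commutativeMonoid = record
  { Carrier = Poly ; _≈_ = _≋_ ; _∙_ = _+_ ; ε = []
  ; isCommutativeMonoid = record
    { isMonoid = record
      { isSemigroup = record
        { isMagma = record
          { isEquivalence = record { refl = ≋-refl ; sym = ≋-sym ; trans = ≋-trans }
          ; ∙-cong = +-cong }
        ; assoc = +-assoc }
      ; identity = +-identityˡ , +-identityʳ }
    ; comm = +-comm } }

module ≋-Reasoning = SetoidReasoning (CommutativeMonoid.setoid +-commutativeMonoid)
open CommutativeSemigroupProperties
  (CommutativeMonoid.commutativeSemigroup +-commutativeMonoid) using (x∙yz≈y∙xz; interchange)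

scale-cong : ∀ a → p ≋ r → scale a p ≋ scale a r
scale-cong {p} {r} a e .at i
  rewrite coeff-scale a p i | coeff-scale a r i = cong (a ℤ.*_) (e .at i)

scale-+ : ∀ a p r → scale a (p + r) ≋ scale a p + scale a r
scale-+ a p r .at i
  rewrite coeff-scale a (p + r) i | coeff-+ (scale a p) (scale a r) i | coeff-+ p r i
        | coeff-scale a p i | coeff-scale a r i
  = ℤₚ.*-distribˡ-+ a (coeff p i) (coeff r i)

+-scale : ∀ a b p → scale (a ℤ.+ b) p ≋ scale a p + scale b p
+-scale a b p .at i
  rewrite coeff-scale (a ℤ.+ b) p i | coeff-+ (scale a p) (scale b p) i
        | coeff-scale a p i | coeff-scale b p i
  = ℤₚ.*-distribʳ-+ (coeff p i) a b

scale-scale : ∀ a b p → scale (a ℤ.* b) p ≋ scale a (scale b p)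
scale-scale a b p .at i
  rewrite coeff-scale (a ℤ.* b) p i | coeff-scale a (scale b p) i | coeff-scale b p i
  = ℤₚ.*-assoc a b (coeff p i)

scale-zero : ∀ p → scale 0ℤ p ≋ []
scale-zero p .at i rewrite coeff-scale 0ℤ p i = refl

scale-one : ∀ p → scale 1ℤ p ≋ p
scale-one p .at i rewrite coeff-scale 1ℤ p i = ℤₚ.*-identityˡ (coeff p i)

*-zeroʳ : ∀ p → p * [] ≋ []
*-zeroʳ []      = ≋-refl
*-zeroʳ (a ∷ p) = ≋-trans (∷-cong refl (*-zeroʳ p)) 0∷[]

*-congˡ : ∀ p → r ≋ r′ → p * r ≋ p * r′
*-congˡ []      e = ≋-refl
*-congˡ (a ∷ p) e = +-cong (scale-cong a e) (∷-cong refl (*-congˡ p e))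

-- Multiplication is defined by recursion on its left factor; this is the mirrored recursion on the
-- right factor, from which commutativity follows at once.
*-∷ : ∀ p b r → p * (b ∷ r) ≋ scale b p + (0ℤ ∷ p * r)
*-∷ []      b r = ≋-sym 0∷[]
*-∷ (a ∷ p) b r = ∷-cong
  (cong (ℤ._+ 0ℤ) (ℤₚ.*-comm a b))
  (≋-trans (+-cong ≋-refl (*-∷ p b r)) (x∙yz≈y∙xz (scale a r) (scale b p) _))

*-comm : ∀ p r → p * r ≋ r * p
*-comm []      r = ≋-sym (*-zeroʳ r)
*-comm (a ∷ p) r = ≋-trans (+-cong ≋-refl (∷-cong refl (*-comm p r))) (≋-sym (*-∷ r a p))

*-cong : p ≋ p′ → r ≋ r′ → p * r ≋ p′ * r′
*-cong {p} {p′} {r} {r′} e f = begin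
  p * r    ≈⟨ *-congˡ p f ⟩
  p * r′   ≈⟨ *-comm p r′ ⟩
  r′ * p   ≈⟨ *-congˡ r′ e ⟩
  r′ * p′  ≈⟨ *-comm r′ p′ ⟩
  p′ * r′  ∎
  where open ≋-Reasoning

*-distribʳ : ∀ s p r → (p + r) * s ≋ p * s + r * s
*-distribʳ s []      r       = ≋-refl
*-distribʳ s (a ∷ p) []      = ≋-sym (+-identityʳ _)
*-distribʳ s (a ∷ p) (b ∷ r) = begin
  scale (a ℤ.+ b) s + (0ℤ ∷ (p + r) * s)
    ≈⟨ +-cong (+-scale a b s) (∷-cong refl (*-distribʳ s p r)) ⟩
  (scale a s + scale b s) + ((0ℤ ∷ p * s) + (0ℤ ∷ r * s))
    ≈⟨ interchange (scale a s) (scale b s) (0ℤ ∷ p * s) (0ℤ ∷ r * s) ⟩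
  (scale a s + (0ℤ ∷ p * s)) + (scale b s + (0ℤ ∷ r * s)) ∎
  where open ≋-Reasoning

scale-* : ∀ a p r → scale a p * r ≋ scale a (p * r)
scale-* a []      r = ≋-refl
scale-* a (b ∷ p) r = begin
  scale (a ℤ.* b) r + (0ℤ ∷ scale a p * r)
    ≈⟨ +-cong (scale-scale a b r) (∷-cong (≡.sym (ℤₚ.*-zeroʳ a)) (scale-* a p r)) ⟩
  scale a (scale b r) + scale a (0ℤ ∷ p * r)
    ≈⟨ scale-+ a (scale b r) (0ℤ ∷ p * r) ⟨
  scale a (scale b r + (0ℤ ∷ p * r)) ∎
  where open ≋-Reasoning

shift-* : ∀ p r → (0ℤ ∷ p) * r ≋ 0ℤ ∷ p * r
shift-* p r = +-cong (scale-zero r) ≋-refl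

*-assoc : ∀ p r s → (p * r) * s ≋ p * (r * s)
*-assoc []      r s = ≋-refl
*-assoc (a ∷ p) r s = begin
  (scale a r + (0ℤ ∷ p * r)) * s      ≈⟨ *-distribʳ s (scale a r) (0ℤ ∷ p * r) ⟩
  scale a r * s + (0ℤ ∷ p * r) * s    ≈⟨ +-cong (scale-* a r s) (shift-* (p * r) s) ⟩
  scale a (r * s) + (0ℤ ∷ p * r * s)  ≈⟨ +-cong ≋-refl (∷-cong refl (*-assoc p r s)) ⟩
  scale a (r * s) + (0ℤ ∷ p * (r * s)) ∎
  where open ≋-Reasoning

*-identityˡ : ∀ p → 1# * p ≋ p
*-identityˡ p = ≋-trans (+-cong (scale-one p) 0∷[]) (+-identityʳ p)

polyRing : CommutativeRing 0ℓ 0ℓ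
polyRing = record
  { Carrier = Poly ; _≈_ = _≋_ ; _+_ = _+_ ; _*_ = _*_ ; -_ = -_ ; 0# = [] ; 1# = 1#
  ; isCommutativeRing = record
    { isRing = record
      { +-isAbelianGroup = record
        { isGroup = record
          { isMonoid = CommutativeMonoid.isMonoid +-commutativeMonoid
          ; inverse = -‿inverseˡ , -‿inverseʳ
          ; ⁻¹-cong = -‿cong }
        ; comm = +-comm }
      ; *-cong = *-cong
      ; *-assoc = *-assoc
      ; *-identity = *-identityˡ , λ p → ≋-trans (*-comm p 1#) (*-identityˡ p)
      ; distrib = (λ s p r → ≋-trans (*-comm s (p + r)) (≋-trans (*-distribʳ s p r)
                    (+-cong (*-comm p s) (*-comm r s)))) , *-distribʳ }
    ; *-comm = *-comm } }

open CommutativeRing polyRing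
  using (isEquivalence; reflexive; distribˡ; *-congʳ; *-identityʳ; *-isCommutativeMonoid)
open import Algebra.Solver.Ring.NaturalCoefficients.Default
  (CommutativeRing.commutativeSemiring polyRing) using (solve; con; _:+_; _:*_; _:=_)

-- Cancellation

-- Everything cancelled below, namely q-integers with positive index, q-factorials, and products of
-- q-integers or of factors 1 - q^k with k ≥ 1, has constant term 1. So cancellation can be proved
-- degree by degree.
HasUnitConstant : Poly → Set
HasUnitConstant p = coeff p 0 ≡ 1ℤ

coeff-*₀ : ∀ p r → coeff (p * r) 0 ≡ coeff p 0 ℤ.* coeff r 0
coeff-*₀ []      r = refl
coeff-*₀ (a ∷ p) r rewrite coeff-+ (scale a r) (0ℤ ∷ p * r) 0 | coeff-scale a r 0 =
  ℤₚ.+-identityʳ _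

unitConstant-* : HasUnitConstant p → HasUnitConstant r → HasUnitConstant (p * r)
unitConstant-* {p} {r} e f = ≡.trans (coeff-*₀ p r) (cong₂ ℤ._*_ e f)

unitConstant-product : ∀ {ps} → All HasUnitConstant ps → HasUnitConstant (product ps)
unitConstant-product [] = refl
unitConstant-product {p ∷ ps} (e ∷ es) = unitConstant-* {p} {product ps} e (unitConstant-product es)

-- The constant term of `p * z` is that of `z`, so the head of `z` vanishes; then `p * z` is a shift
-- of `p` times the tail, and induction applies.
unitConstant⇒nonZeroDivisor : ∀ p z → HasUnitConstant p → p * z ≋ [] → z ≋ []
unitConstant⇒nonZeroDivisor p []      e h = ≋-refl
unitConstant⇒nonZeroDivisor p (c ∷ z) e h = ≋-trans (∷-cong c≡0 z≋0) 0∷[]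
  where
  open ≋-Reasoning
  c≡0 : c ≡ 0ℤ
  c≡0 = ≡.trans (≡.sym (ℤₚ.*-identityˡ c)) (≡.trans (cong (ℤ._* c) (≡.sym e))
          (≡.trans (≡.sym (coeff-*₀ p (c ∷ z))) (h .at 0)))
  z≋0 : z ≋ []
  z≋0 = unitConstant⇒nonZeroDivisor p z e (tail-≋ (begin
    0ℤ ∷ p * z                 ≈⟨ +-cong (scale-zero p) ≋-refl ⟨
    scale 0ℤ p + (0ℤ ∷ p * z)  ≈⟨ *-∷ p 0ℤ z ⟨
    p * (0ℤ ∷ z)               ≈⟨ *-congˡ p (∷-cong (≡.sym c≡0) ≋-refl) ⟩
    p * (c ∷ z)                ≈⟨ h ⟩
    []                         ≈⟨ 0∷[] ⟨
    0ℤ ∷ []                    ∎))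

*-cancelˡ : ∀ p → HasUnitConstant p → p * r ≋ p * s → r ≋ s
*-cancelˡ {r} {s} p e h = x∙y⁻¹≈ε⇒x≈y r s (unitConstant⇒nonZeroDivisor p (r + - s) e (begin
  p * (r + - s)      ≈⟨ distribˡ p r (- s) ⟩
  p * r + p * - s    ≈⟨ +-cong h (≋-sym (-‿distribʳ-* p s)) ⟩
  p * s + - (p * s)  ≈⟨ -‿inverseʳ (p * s) ⟩
  []                 ∎))
  where
  open ≋-Reasoning
  open GroupProperties (CommutativeRing.+-group polyRing) using (x∙y⁻¹≈ε⇒x≈y)
  open RingProperties (CommutativeRing.ring polyRing) using (-‿distribʳ-*)

*-cancelʳ : ∀ p → HasUnitConstant p → r * p ≋ s * p → r ≋ s
*-cancelʳ {r} {s} p e h = *-cancelˡ p e (begin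
  p * r  ≈⟨ *-comm p r ⟩
  r * p  ≈⟨ h ⟩
  s * p  ≈⟨ *-comm s p ⟩
  p * s  ∎)
  where open ≋-Reasoning

-- Sums and products over lists

sum-++ : ∀ ps rs → sum (ps ++ rs) ≋ sum ps + sum rs
sum-++ []       rs = ≋-refl
sum-++ (p ∷ ps) rs = ≋-trans (+-cong ≋-refl (sum-++ ps rs)) (≋-sym (+-assoc p (sum ps) (sum rs)))

product-++ : ∀ ps rs → product (ps ++ rs) ≋ product ps * product rs
product-++ []       rs = ≋-sym (*-identityˡ (product rs))
product-++ (p ∷ ps) rs = ≋-trans (*-congˡ p (product-++ ps rs)) (≋-sym (*-assoc p _ _))

sum-*ˡ : ∀ {A : Set} c (f g : A → Poly) → (∀ x → f x ≋ c * g x) →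
         ∀ xs → sum (map f xs) ≋ c * sum (map g xs)
sum-*ˡ c f g e []       = ≋-sym (*-zeroʳ c)
sum-*ˡ c f g e (x ∷ xs) =
  ≋-trans (+-cong (e x) (sum-*ˡ c f g e xs)) (≋-sym (distribˡ c (g x) (sum (map g xs))))

-- The hook length formula

q^suc-* : ∀ k p → q^ suc k * p ≋ 0ℤ ∷ q^ k * p
q^suc-* k p = shift-* (q^ k) p

q^-+ : ∀ k l → q^ (k ℕ.+ l) ≋ q^ k * q^ l
q^-+ zero    l = ≋-sym (*-identityˡ (q^ l))
q^-+ (suc k) l = ≋-trans (∷-cong refl (q^-+ k l)) (≋-sym (q^suc-* k (q^ l)))

[]q-+ : ∀ k l → [ k ℕ.+ l ]q ≋ [ k ]q + q^ k * [ l ]q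
[]q-+ zero    l = ≋-sym (*-identityˡ [ l ]q)
[]q-+ (suc k) l = begin
  1ℤ ∷ [ k ℕ.+ l ]q                    ≈⟨ ∷-cong refl ([]q-+ k l) ⟩
  (1ℤ ∷ [ k ]q) + (0ℤ ∷ q^ k * [ l ]q) ≈⟨ +-cong (≋-refl {[ suc k ]q}) (q^suc-* k [ l ]q) ⟨
  [ suc k ]q + q^ suc k * [ l ]q       ∎
  where open ≋-Reasoning

qProduct : List ℕ → Poly
qProduct ks = product (map [_]q ks)

qProduct-++ : ∀ ks ls → qProduct (ks ++ ls) ≋ qProduct ks * qProduct ls
qProduct-++ ks ls =
  ≋-trans (reflexive (cong product (map-++ [_]q ks ls))) (product-++ (map [_]q ks) (map [_]q ls))

hooks′ : List Tree → List ℕ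
hooks′ []             = []
hooks′ (node us ∷ ts) = suc (edges′ us) ∷ hooks′ us ++ hooks′ ts

hooks : Tree → List ℕ
hooks (node ts) = hooks′ ts

hookProduct : List Tree → Poly
hookProduct ts = qProduct (hooks′ ts)

hookProduct-∷ : ∀ us ts →
  hookProduct (node us ∷ ts) ≋ [ suc (edges′ us) ]q * (hookProduct us * hookProduct ts)
hookProduct-∷ us ts = *-congˡ [ suc (edges′ us) ]q (qProduct-++ (hooks′ us) (hooks′ ts))

-- The sum in the recursion for `Q`, with arbitrary values `f v` in place of the plucking
-- polynomials of the smaller trees. This freedom lets constant factors be moved into `f` when
-- passing to subforests.
leafSum : ∀ ts → (Leaf′ ts → Poly) → Poly
leafSum ts f = sum (map (λ v → q^ right′ v * f v) (leaves′ ts))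

leafSum-next : ∀ t ts (f : Leaf′ (t ∷ ts) → Poly) →
  sum (map (λ v → q^ right′ v * f v) (map next (leaves′ ts))) ≡ leafSum ts (f ∘ next)
leafSum-next t ts f = cong sum (≡.sym (map-∘ (leaves′ ts)))

leafSum-here : ∀ ts (f : Leaf′ (node [] ∷ ts) → Poly) →
  leafSum (node [] ∷ ts) f ≋ q^ edges′ ts * f here + leafSum ts (f ∘ next)
leafSum-here ts f = +-cong ≋-refl (reflexive (leafSum-next (node []) ts f))

-- The path to a leaf of the first subtree has all of `ts` on its right, whence the common factor. A
-- leaf of `ts` has no edge of the first subtree on its right, so its weight is unchanged.
leafSum-below : ∀ u us ts (f : Leaf′ (node (u ∷ us) ∷ ts) → Poly) →
  leafSum (node (u ∷ us) ∷ ts) f ≋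
  q^ edges′ ts * leafSum (u ∷ us) (f ∘ below) + leafSum ts (f ∘ next)
leafSum-below u us ts f = begin
  sum (map g (map below (leaves′ (u ∷ us)) ++ map next (leaves′ ts)))
    ≡⟨ cong sum (map-++ g (map below (leaves′ (u ∷ us))) (map next (leaves′ ts))) ⟩
  sum (map g (map below (leaves′ (u ∷ us))) ++ map g (map next (leaves′ ts)))
    ≈⟨ sum-++ (map g (map below (leaves′ (u ∷ us)))) _ ⟩
  sum (map g (map below (leaves′ (u ∷ us)))) + sum (map g (map next (leaves′ ts)))
    ≡⟨ cong₂ _+_ (cong sum (≡.sym (map-∘ (leaves′ (u ∷ us))))) (leafSum-next (node (u ∷ us)) ts f) ⟩
  sum (map (g ∘ below) (leaves′ (u ∷ us))) + leafSum ts (f ∘ next)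
    ≈⟨ +-cong (sum-*ˡ (q^ edges′ ts) (g ∘ below) (λ v → q^ right′ v * f (below v)) factor
                      (leaves′ (u ∷ us))) ≋-refl ⟩
  q^ edges′ ts * leafSum (u ∷ us) (f ∘ below) + leafSum ts (f ∘ next) ∎
  where
  open ≋-Reasoning
  g : Leaf′ (node (u ∷ us) ∷ ts) → Poly
  g v = q^ right′ v * f v
  factor : ∀ v → g (below v) ≋ q^ edges′ ts * (q^ right′ v * f (below v))
  factor v = begin
    q^ (right′ v ℕ.+ edges′ ts) * f (below v)
      ≈⟨ *-congʳ (q^-+ (right′ v) (edges′ ts)) ⟩
    (q^ right′ v * q^ edges′ ts) * f (below v)
      ≈⟨ solve 3 (λ x y z → (x :* y) :* z := y :* (x :* z)) ≋-refl
           (q^ right′ v) (q^ edges′ ts) (f (below v)) ⟩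
    q^ edges′ ts * (q^ right′ v * f (below v)) ∎

leafSum-*ʳ : ∀ {ts} d (f : Leaf′ ts → Poly) → leafSum ts (λ v → f v * d) ≋ leafSum ts f * d
leafSum-*ʳ {ts} d f = ≋-trans
  (sum-*ˡ d _ (λ v → q^ right′ v * f v)
    (λ v → solve 3 (λ x y d → x :* (y :* d) := d :* (x :* y)) ≋-refl (q^ right′ v) (f v) d)
    (leaves′ ts))
  (*-comm d (leafSum ts f))

unitConstant-edges : ∀ u us → HasUnitConstant [ edges′ (u ∷ us) ]q
unitConstant-edges (node _) _ = refl

-- If f v is c / hookProduct (ts − v), then the ratios hookProduct ts / hookProduct (ts − v),
-- weighted by q^(right′ v), add up to [ edges′ ts ]q.
LeafSumIdentity : List Tree → Set
LeafSumIdentity ts = ∀ (f : Leaf′ ts → Poly) c →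
  (∀ v → f v * hookProduct (remove′ v) ≋ c) →
  leafSum ts f * hookProduct ts ≋ c * [ edges′ ts ]q

-- The two groups of leaves account for the two terms of `[ m + suc l ]q = [ m ]q + q^m [ suc l ]q`:
-- those of `ts` give the first term, those of the first subtree the second.
leafSumIdentity-below : ∀ u us ts → LeafSumIdentity (u ∷ us) → LeafSumIdentity ts →
                        LeafSumIdentity (node (u ∷ us) ∷ ts)
leafSumIdentity-below u us ts belowIdentity nextIdentity f c e = begin
  leafSum (node (u ∷ us) ∷ ts) f * hookProduct (node (u ∷ us) ∷ ts)
    ≈⟨ *-cong (leafSum-below u us ts f) (hookProduct-∷ (u ∷ us) ts) ⟩
  (x * S + S′) * ([ suc l ]q * (H * H′))
    ≈⟨ solve 6 (λ x s s′ k h h′ → (x :* s :+ s′) :* (k :* (h :* h′)) :=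
                 (x :* k) :* ((s :* h′) :* h) :+ (s′ :* (k :* h)) :* h′)
         ≋-refl x S S′ [ suc l ]q H H′ ⟩
  (x * [ suc l ]q) * ((S * H′) * H) + (S′ * ([ suc l ]q * H)) * H′
    ≈⟨ +-cong (*-congˡ (x * [ suc l ]q) lower) upper ⟩
  (x * [ suc l ]q) * c + c * [ m ]q
    ≈⟨ solve 4 (λ x k c j → (x :* k) :* c :+ c :* j := c :* (j :+ x :* k)) ≋-refl
         x [ suc l ]q c [ m ]q ⟩
  c * ([ m ]q + x * [ suc l ]q)
    ≈⟨ *-congˡ c ([]q-+ m (suc l)) ⟨
  c * [ m ℕ.+ suc l ]q
    ≡⟨ cong (λ k → c * [ k ]q) (ℕₚ.+-comm m (suc l)) ⟩
  c * [ suc l ℕ.+ m ]q ∎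
  where
  open ≋-Reasoning
  m = edges′ ts
  l = edges′ (u ∷ us)
  x = q^ m
  H = hookProduct (u ∷ us)
  H′ = hookProduct ts
  S = leafSum (u ∷ us) (f ∘ below)
  S′ = leafSum ts (f ∘ next)

  -- Removing a leaf of the first subtree lowers the hook of its bottom vertex from `suc l` to `l`.
  -- The identity for `u ∷ us` therefore yields this equation times `[ l ]q`, which can be cancelled
  -- because `l` is positive.
  lower : (S * H′) * H ≋ c
  lower = *-cancelʳ [ l ]q (unitConstant-edges u us) (begin
    ((S * H′) * H) * [ l ]q
      ≈⟨ solve 4 (λ s h′ h k → ((s :* h′) :* h) :* k := (s :* (h′ :* k)) :* h) ≋-refl
           S H′ H [ l ]q ⟩
    (S * (H′ * [ l ]q)) * H
      ≈⟨ *-congʳ (leafSum-*ʳ (H′ * [ l ]q) (f ∘ below)) ⟨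
    leafSum (u ∷ us) (λ v → f (below v) * (H′ * [ l ]q)) * H
      ≈⟨ belowIdentity (λ v → f (below v) * (H′ * [ l ]q)) c removed ⟩
    c * [ l ]q ∎)
    where
    removed : ∀ v → (f (below v) * (H′ * [ l ]q)) * hookProduct (remove′ v) ≋ c
    removed v = begin
      (f (below v) * (H′ * [ l ]q)) * hookProduct (remove′ v)
        ≈⟨ solve 4 (λ y h′ k h → (y :* (h′ :* k)) :* h := y :* (k :* (h :* h′))) ≋-refl
             (f (below v)) H′ [ l ]q (hookProduct (remove′ v)) ⟩
      f (below v) * ([ l ]q * (hookProduct (remove′ v) * H′))
        ≡⟨ cong (λ k → f (below v) * ([ k ]q * (hookProduct (remove′ v) * H′))) (edges-remove v) ⟩
      f (below v) * ([ suc (edges′ (remove′ v)) ]q * (hookProduct (remove′ v) * H′))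
        ≈⟨ *-congˡ (f (below v)) (hookProduct-∷ (remove′ v) ts) ⟨
      f (below v) * hookProduct (node (remove′ v) ∷ ts)
        ≈⟨ e (below v) ⟩
      c ∎

  -- Removing a leaf of `ts` leaves the hooks of the first subtree intact, so they enter as a
  -- constant factor.
  upper : (S′ * ([ suc l ]q * H)) * H′ ≋ c * [ m ]q
  upper = begin
    (S′ * ([ suc l ]q * H)) * H′
      ≈⟨ *-congʳ (leafSum-*ʳ ([ suc l ]q * H) (f ∘ next)) ⟨
    leafSum ts (λ v → f (next v) * ([ suc l ]q * H)) * H′
      ≈⟨ nextIdentity (λ v → f (next v) * ([ suc l ]q * H)) c removed ⟩
    c * [ m ]q ∎
    where
    removed : ∀ v → (f (next v) * ([ suc l ]q * H)) * hookProduct (remove′ v) ≋ c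
    removed v = begin
      (f (next v) * ([ suc l ]q * H)) * hookProduct (remove′ v)
        ≈⟨ solve 4 (λ y k h h′ → (y :* (k :* h)) :* h′ := y :* (k :* (h :* h′))) ≋-refl
             (f (next v)) [ suc l ]q H (hookProduct (remove′ v)) ⟩
      f (next v) * ([ suc l ]q * (H * hookProduct (remove′ v)))
        ≈⟨ *-congˡ (f (next v)) (hookProduct-∷ (u ∷ us) (remove′ v)) ⟨
      f (next v) * hookProduct (node (u ∷ us) ∷ remove′ v)
        ≈⟨ e (next v) ⟩
      c ∎

leafSumIdentity : ∀ ts → LeafSumIdentity ts
-- There are no leaves, and `[ 0 ]q` is zero.
leafSumIdentity [] f c e = ≋-sym (*-zeroʳ c)
-- Here the first subtree is itself a leaf: plucking it deletes its hook 1 altogether, and the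
-- argument of the other case would have to cancel `[ 0 ]q`.
leafSumIdentity (node [] ∷ ts) f c e = begin
  leafSum (node [] ∷ ts) f * (1# * H)
    ≈⟨ *-cong (leafSum-here ts f) (*-identityˡ H) ⟩
  (x * f here + S) * H
    ≈⟨ solve 4 (λ x y s h → (x :* y :+ s) :* h := x :* (y :* h) :+ s :* h) ≋-refl x (f here) S H ⟩
  x * (f here * H) + S * H
    ≈⟨ +-cong (*-congˡ x (e here)) (leafSumIdentity ts (f ∘ next) c
         (λ v → ≋-trans (*-congˡ (f (next v)) (≋-sym (*-identityˡ _))) (e (next v)))) ⟩
  x * c + c * [ m ]q
    ≈⟨ solve 3 (λ x c k → x :* c :+ c :* k := c :* (k :+ x)) ≋-refl x c [ m ]q ⟩
  c * ([ m ]q + x)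
    ≈⟨ *-congˡ c (+-cong ≋-refl (*-identityʳ x)) ⟨
  c * ([ m ]q + x * [ 1 ]q)
    ≈⟨ *-congˡ c ([]q-+ m 1) ⟨
  c * [ m ℕ.+ 1 ]q
    ≡⟨ cong (λ k → c * [ k ]q) (ℕₚ.+-comm m 1) ⟩
  c * [ suc m ]q ∎
  where
  open ≋-Reasoning
  m = edges′ ts
  x = q^ m
  H = hookProduct ts
  S = leafSum ts (f ∘ next)
leafSumIdentity (node (u ∷ us) ∷ ts) =
  leafSumIdentity-below u us ts (leafSumIdentity (u ∷ us)) (leafSumIdentity ts)

-- By induction every tree with one leaf removed satisfies the formula with the same right-hand side
-- `[ n ]q!`, which serves as the constant `c` of `leafSumIdentity`; that identity then supplies the
-- new factor `[ suc n ]q`.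
hookFormula : ∀ T → Q T * qProduct (hooks T) ≋ [ edges T ]q!
hookFormula T = byEdges (edges T) T refl
  where
  open ≋-Reasoning
  byEdges : ∀ n T → edges T ≡ n → pluck n T * qProduct (hooks T) ≋ [ n ]q!
  byEdges zero    (node []) eq = *-identityˡ 1#
  byEdges zero    (node (node _ ∷ _)) ()
  byEdges (suc n) (node ts) eq = begin
    leafSum ts (λ v → pluck n (node (remove′ v))) * hookProduct ts
      ≈⟨ leafSumIdentity ts (λ v → pluck n (node (remove′ v))) [ n ]q!
           (λ v → byEdges n (node (remove′ v))
                    (ℕₚ.suc-injective (≡.trans (≡.sym (edges-remove v)) eq))) ⟩
    [ n ]q! * [ edges′ ts ]q  ≡⟨ cong (λ k → [ n ]q! * [ k ]q) eq ⟩
    [ n ]q! * [ suc n ]q      ≈⟨ *-comm [ n ]q! [ suc n ]q ⟩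
    [ suc n ]q!               ∎

-- Reduced forms

product-↭ : ∀ {ps rs} → ps ↭ rs → product ps ≋ product rs
product-↭ σ =
  foldr-commMonoid (CommutativeRing.setoid polyRing) *-isCommutativeMonoid (↭⇒↭ₛ′ isEquivalence σ)

qProduct-↭ : ks ↭ ls → qProduct ks ≋ qProduct ls
qProduct-↭ σ = product-↭ (map⁺ [_]q σ)

unitConstant-[]q : ∀ {k} → 1 ≤ k → HasUnitConstant [ k ]q
unitConstant-[]q (s≤s _) = refl

unitConstant-qProduct : All (1 ≤_) ks → HasUnitConstant (qProduct ks)
unitConstant-qProduct ks≥1 = unitConstant-product (Allₚ.map⁺ (All.map unitConstant-[]q ks≥1))

unitConstant-! : ∀ n → HasUnitConstant [ n ]q!
unitConstant-! zero    = refl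
unitConstant-! (suc n) = unitConstant-* {[ suc n ]q} {[ n ]q!} refl (unitConstant-! n)

range : ℕ → List ℕ
range = applyDownFrom suc

qProduct-range : ∀ n → qProduct (range n) ≡ [ n ]q!
qProduct-range zero    = refl
qProduct-range (suc n) = cong ([ suc n ]q *_) (qProduct-range n)

range≥1 : ∀ n → All (1 ≤_) (range n)
range≥1 n = Allₚ.applyDownFrom⁺₂ suc n (λ _ → s≤s z≤n)

range-Unique : ∀ n → Unique (range n)
range-Unique n = Uniqueₚ.applyDownFrom⁺₁ suc n λ j<i _ eq → ℕₚ.<⇒≢ j<i (≡.sym (ℕₚ.suc-injective eq))

hooks≥1 : ∀ ts → All (1 ≤_) (hooks′ ts)
hooks≥1 []             = []
hooks≥1 (node us ∷ ts) = s≤s z≤n ∷ Allₚ.++⁺ (hooks≥1 us) (hooks≥1 ts)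

-- Cancellation of common entries with multiplicity. `ks′` is a sublist of `ks`, not merely part of
-- it up to reordering, so that uniqueness of `ks` passes to it directly.
record Cancellation (ks ls : List ℕ) : Set where
  field
    ks′ ls′ common : List ℕ
    ks′⊆     : ks′ ⊆ ks
    ks↭      : ks ↭ ks′ ++ common
    ls↭      : ls ↭ ls′ ++ common
    disjoint : Disjoint ks′ ls′

∈⇒↭ : ∀ {A : Set} {x : A} {xs} → x ∈ xs → ∃ λ ys → xs ↭ x ∷ ys
∈⇒↭ {x = x} x∈xs with ys , zs , refl ← ∈-∃++ x∈xs = ys ++ zs , shift x ys zs

cancel : ∀ ks ls → Cancellation ks ls
cancel [] ls = record
  { ks′ = [] ; ls′ = ls ; common = [] ; ks′⊆ = [] ; ks↭ = ↭-refl
  ; ls↭ = ↭-sym (++-comm ls []) ; disjoint = λ () }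
cancel (k ∷ ks) ls with cancel ks ls
... | c with k ∈? Cancellation.ls′ c
...   | yes k∈ls′ = let ls″ , σ = ∈⇒↭ k∈ls′ in record
  { ks′ = C.ks′ ; ls′ = ls″ ; common = k ∷ C.common
  ; ks′⊆ = k ∷ʳ C.ks′⊆
  ; ks↭ = ↭-trans (↭-prep k C.ks↭) (↭-sym (shift k C.ks′ C.common))
  ; ls↭ = ↭-trans C.ls↭ (↭-trans (++⁺ʳ C.common σ) (↭-sym (shift k ls″ C.common)))
  ; disjoint = λ (x∈ks′ , x∈ls″) → C.disjoint (x∈ks′ , ∈-resp-↭ (↭-sym σ) (there x∈ls″)) }
  where module C = Cancellation c
...   | no k∉ls′ = record
  { ks′ = k ∷ C.ks′ ; ls′ = C.ls′ ; common = C.common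
  ; ks′⊆ = refl ∷ C.ks′⊆
  ; ks↭ = ↭-prep k C.ks↭
  ; ls↭ = C.ls↭
  ; disjoint = λ { (here refl , k∈ls′) → k∉ls′ k∈ls′
                 ; (there x∈ks′ , x∈ls′) → C.disjoint (x∈ks′ , x∈ls′) } }
  where module C = Cancellation c

Unique-resp-⊆ : ∀ {A : Set} {xs ys : List A} → xs ⊆ ys → Unique ys → Unique xs
Unique-resp-⊆ []          []           = []
Unique-resp-⊆ (_ ∷ʳ τ)    (_ ∷ u)      = Unique-resp-⊆ τ u
Unique-resp-⊆ (refl ∷ τ)  (x∉ ∷ u)     = All-resp-⊆ τ x∉ ∷ Unique-resp-⊆ τ u

qProduct-filter : All (1 ≤_) ks → qProduct (filter (2 ≤?_) ks) ≋ qProduct ks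
qProduct-filter [] = ≋-refl
qProduct-filter {1 ∷ ks} (_ ∷ ks≥1) =
  ≋-trans (qProduct-filter ks≥1) (≋-sym (*-identityˡ (qProduct ks)))
qProduct-filter {suc (suc k) ∷ ks} (_ ∷ ks≥1) = *-congˡ [ suc (suc k) ]q (qProduct-filter ks≥1)

-- A reduced form arises by dropping the factors `[ 1 ]q` and cancelling common ones. Both steps
-- only delete entries of `ks`, so no repetition can appear.
numeratorDoesNotRepeat : ∀ P ks ls → All (1 ≤_) ks → All (1 ≤_) ls → Unique ks →
  P * qProduct ls ≋ qProduct ks → NumeratorDoesNotRepeat P
numeratorDoesNotRepeat P ks ls ks≥1 ls≥1 ks! e = C.ks′ , C.ls′ , reduced ,
  Unique-resp-⊆ C.ks′⊆ (Uniqueₚ.filter⁺ (2 ≤?_) ks!)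
  where
  ks₂ ls₂ : List ℕ
  ks₂ = filter (2 ≤?_) ks
  ls₂ = filter (2 ≤?_) ls
  module C = Cancellation (cancel ks₂ ls₂)
  ls′≥2×common≥2 : All (2 ≤_) C.ls′ × All (2 ≤_) C.common
  ls′≥2×common≥2 = Allₚ.++⁻ C.ls′ (All-resp-↭ C.ls↭ (Allₚ.all-filter (2 ≤?_) ls))
  open ≋-Reasoning
  reduced : IsReducedForm P C.ks′ C.ls′
  reduced = record
    { as≥2 = All-resp-⊆ C.ks′⊆ (Allₚ.all-filter (2 ≤?_) ks)
    ; bs≥2 = proj₁ ls′≥2×common≥2
    ; disjoint = C.disjoint
    ; quotient = at (*-cancelʳ {r = P * qProduct C.ls′} {s = qProduct C.ks′} (qProduct C.common)
        (unitConstant-qProduct (All.map (ℕₚ.≤-trans (s≤s z≤n)) (proj₂ ls′≥2×common≥2)))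
        (begin
          (P * qProduct C.ls′) * qProduct C.common ≈⟨ *-assoc P _ _ ⟩
          P * (qProduct C.ls′ * qProduct C.common) ≈⟨ *-congˡ P (qProduct-++ C.ls′ C.common) ⟨
          P * qProduct (C.ls′ ++ C.common)         ≈⟨ *-congˡ P (qProduct-↭ C.ls↭) ⟨
          P * qProduct ls₂                         ≈⟨ *-congˡ P (qProduct-filter ls≥1) ⟩
          P * qProduct ls                          ≈⟨ e ⟩
          qProduct ks                              ≈⟨ qProduct-filter ks≥1 ⟨
          qProduct ks₂                             ≈⟨ qProduct-↭ C.ks↭ ⟩
          qProduct (C.ks′ ++ C.common)             ≈⟨ qProduct-++ C.ks′ C.common ⟩
          qProduct C.ks′ * qProduct C.common       ∎)) }

Q-numeratorDoesNotRepeat : ∀ T → Q T ≋ p → NumeratorDoesNotRepeat p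
Q-numeratorDoesNotRepeat {p} T@(node ts) e =
  numeratorDoesNotRepeat p (range (edges T)) (hooks T)
    (range≥1 (edges T)) (hooks≥1 ts) (range-Unique (edges T)) (begin
      p * qProduct (hooks T)      ≈⟨ *-congʳ e ⟨
      Q T * qProduct (hooks T)    ≈⟨ hookFormula T ⟩
      [ edges T ]q!               ≡⟨ qProduct-range (edges T) ⟨
      qProduct (range (edges T))  ∎)
  where open ≋-Reasoning

-- Unique factorisation into q-integers

1-q^_ : ℕ → Poly
1-q^ k = 1# + - (q^ k)

1-q^-* : ∀ k p → (1-q^ k) * p ≋ p + - (q^ k * p)
1-q^-* k p = ≋-trans (*-distribʳ p 1# (- (q^ k)))
  (+-cong (*-identityˡ p) (≋-sym (-‿distribˡ-* (q^ k) p)))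
  where open RingProperties (CommutativeRing.ring polyRing) using (-‿distribˡ-*)

-- Splitting `[ k + 1 ]q` at its last term and at its first gives two expressions for it; comparing
-- them is the telescoping of the product.
[]q*1-q : ∀ k → [ k ]q * (1-q^ 1) ≋ 1-q^ k
[]q*1-q k = begin
  [ k ]q * (1-q^ 1)                      ≈⟨ *-comm [ k ]q (1-q^ 1) ⟩
  (1-q^ 1) * [ k ]q                      ≈⟨ 1-q^-* 1 [ k ]q ⟩
  [ k ]q + - z                           ≈⟨ +-cong (≋-sym (+-identityʳ [ k ]q)) ≋-refl ⟩
  ([ k ]q + []) + - z                    ≈⟨ +-cong (+-cong (≋-refl {[ k ]q}) (-‿inverseʳ (q^ k))) ≋-refl ⟨
  ([ k ]q + (q^ k + - (q^ k))) + - z     ≈⟨ +-cong (+-assoc [ k ]q (q^ k) (- (q^ k))) ≋-refl ⟨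
  (([ k ]q + q^ k) + - (q^ k)) + - z     ≈⟨ +-cong (+-cong recurrence ≋-refl) ≋-refl ⟩
  ((1# + z) + - (q^ k)) + - z
    ≈⟨ solve 4 (λ o z y w → ((o :+ z) :+ y) :+ w := (o :+ y) :+ (z :+ w)) ≋-refl
         1# z (- (q^ k)) (- z) ⟩
  (1-q^ k) + (z + - z)                   ≈⟨ +-cong (≋-refl {1-q^ k}) (-‿inverseʳ z) ⟩
  (1-q^ k) + []                          ≈⟨ +-identityʳ (1-q^ k) ⟩
  1-q^ k                                 ∎
  where
  open ≋-Reasoning
  z = q^ 1 * [ k ]q
  recurrence : [ k ]q + q^ k ≋ 1# + z
  recurrence = begin
    [ k ]q + q^ k           ≈⟨ +-cong ≋-refl (*-identityʳ (q^ k)) ⟨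
    [ k ]q + q^ k * [ 1 ]q  ≈⟨ []q-+ k 1 ⟨
    [ k ℕ.+ 1 ]q            ≡⟨ cong [_]q (ℕₚ.+-comm k 1) ⟩
    [ 1 ℕ.+ k ]q            ≈⟨ []q-+ 1 k ⟩
    1# + z                  ∎

coeff-1-q^-* : ∀ k p i → coeff ((1-q^ k) * p) i ≡ coeff p i ℤ.- coeff (q^ k * p) i
coeff-1-q^-* k p i = ≡.trans (1-q^-* k p .at i)
  (≡.trans (coeff-+ p (- (q^ k * p)) i) (cong (λ a → coeff p i ℤ.+ a) (coeff-- (q^ k * p) i)))

coeff-q^-*-< : ∀ {i k} p → i < k → coeff (q^ k * p) i ≡ 0ℤ
coeff-q^-*-< {zero}  {suc k} p _         = q^suc-* k p .at 0
coeff-q^-*-< {suc i} {suc k} p (s≤s i<k) = ≡.trans (q^suc-* k p .at (suc i)) (coeff-q^-*-< p i<k)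

coeff-q^-*-≡ : ∀ k p → coeff (q^ k * p) k ≡ coeff p 0
coeff-q^-*-≡ zero    p = *-identityˡ p .at 0
coeff-q^-*-≡ (suc k) p = ≡.trans (q^suc-* k p .at (suc k)) (coeff-q^-*-≡ k p)

1-qProduct : List ℕ → Poly
1-qProduct ks = product (map 1-q^_ ks)

1-qProduct-++ : ∀ ks ls → 1-qProduct (ks ++ ls) ≋ 1-qProduct ks * 1-qProduct ls
1-qProduct-++ ks ls = ≋-trans (reflexive (cong product (map-++ 1-q^_ ks ls)))
  (product-++ (map 1-q^_ ks) (map 1-q^_ ls))

unitConstant-1-q^ : ∀ {k} → 1 ≤ k → HasUnitConstant (1-q^ k)
unitConstant-1-q^ (s≤s _) = refl

unitConstant-1-qProduct : All (1 ≤_) ks → HasUnitConstant (1-qProduct ks)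
unitConstant-1-qProduct ks≥1 = unitConstant-product (Allₚ.map⁺ (All.map unitConstant-1-q^ ks≥1))

occurrences : ℕ → List ℕ → ℕ
occurrences k ks = length (filter (k ≟_) ks)

-- Modulo q^(k+1), a factor 1 - q^l is 1 for l > k, while each factor 1 - q^k contributes -1 to the
-- coefficient of q^k, as the remaining product has constant term 1.
coeff-1-qProduct : ∀ {k} → 1 ≤ k → All (k ≤_) ks →
                   coeff (1-qProduct ks) k ≡ ℤ.- (ℤ.+ occurrences k ks)
coeff-1-qProduct {[]}     {suc k} _ [] = refl
coeff-1-qProduct {l ∷ ks} {k} k≥1 (k≤l ∷ k≤ks) with k ≟ l
... | yes refl = begin
  coeff ((1-q^ k) * D) k
    ≡⟨ coeff-1-q^-* k D k ⟩
  coeff D k ℤ.- coeff (q^ k * D) k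
    ≡⟨ cong₂ ℤ._-_ (coeff-1-qProduct k≥1 k≤ks) (≡.trans (coeff-q^-*-≡ k D) D₀) ⟩
  ℤ.- (ℤ.+ occurrences k ks) ℤ.- 1ℤ
    ≡⟨ ℤₚ.neg-distrib-+ (ℤ.+ occurrences k ks) 1ℤ ⟨
  ℤ.- (ℤ.+ (occurrences k ks ℕ.+ 1))
    ≡⟨ cong (λ n → ℤ.- (ℤ.+ n)) (ℕₚ.+-comm (occurrences k ks) 1) ⟩
  ℤ.- (ℤ.+ suc (occurrences k ks))
    ≡⟨ cong (λ js → ℤ.- (ℤ.+ length js)) (filter-accept (k ≟_) refl) ⟨
  ℤ.- (ℤ.+ occurrences k (k ∷ ks)) ∎
  where
  open ≡.≡-Reasoning
  D = 1-qProduct ks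
  D₀ : HasUnitConstant D
  D₀ = unitConstant-1-qProduct (All.map (ℕₚ.≤-trans k≥1) k≤ks)
... | no k≢l = begin
  coeff ((1-q^ l) * D) k
    ≡⟨ coeff-1-q^-* l D k ⟩
  coeff D k ℤ.- coeff (q^ l * D) k
    ≡⟨ cong₂ ℤ._-_ (coeff-1-qProduct k≥1 k≤ks) (coeff-q^-*-< D (ℕₚ.≤∧≢⇒< k≤l k≢l)) ⟩
  ℤ.- (ℤ.+ occurrences k ks) ℤ.+ 0ℤ
    ≡⟨ ℤₚ.+-identityʳ _ ⟩
  ℤ.- (ℤ.+ occurrences k ks)
    ≡⟨ cong (λ js → ℤ.- (ℤ.+ length js)) (filter-reject (k ≟_) k≢l) ⟨
  ℤ.- (ℤ.+ occurrences k (l ∷ ks)) ∎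
  where
  open ≡.≡-Reasoning
  D = 1-qProduct ks

-- By `coeff-1-qProduct`, equal products contain `k` equally often; for disjoint lists this number
-- must be zero.
raiseBound : ∀ {k} → 1 ≤ k → Disjoint ks ls → 1-qProduct ks ≋ 1-qProduct ls →
             All (k ≤_) ks → All (k ≤_) ls → All (suc k ≤_) ks
raiseBound {ks} {ls} {k} k≥1 ks#ls e k≤ks k≤ls = All.tabulate λ {l} l∈ks →
  ℕₚ.≤∧≢⇒< (All.lookup k≤ks l∈ks) λ { refl → ℕₚ.<⇒≢ (filter-some (k ≟_) l∈ks)
    (≡.trans (≡.sym (occurrences≡0 l∈ks)) (≡.sym same)) }
  where
  same : occurrences k ks ≡ occurrences k ls
  same = ℤₚ.+-injective (ℤₚ.neg-injective (≡.trans (≡.sym (coeff-1-qProduct k≥1 k≤ks))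
    (≡.trans (e .at k) (coeff-1-qProduct k≥1 k≤ls))))
  occurrences≡0 : k ∈ ks → occurrences k ls ≡ 0
  occurrences≡0 k∈ks = cong length (filter-none (k ≟_)
    (All.tabulate λ { l∈ls refl → ks#ls (k∈ks , l∈ls) }))

unbounded⇒[] : (∀ k → All (suc k ≤_) ks) → ks ≡ []
unbounded⇒[] {[]}     _ = refl
unbounded⇒[] {k ∷ ks} h = contradiction (All.head (h k)) ℕₚ.1+n≰n

-- The lower bound on the entries can be raised indefinitely, which only empty lists survive.
1-qProduct-disjoint : All (1 ≤_) ks → All (1 ≤_) ls → Disjoint ks ls →
  1-qProduct ks ≋ 1-qProduct ls → ks ≡ [] × ls ≡ []
1-qProduct-disjoint {ks} {ls} ks≥1 ls≥1 ks#ls e =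
  unbounded⇒[] (proj₁ ∘ bound) , unbounded⇒[] (proj₂ ∘ bound)
  where
  bound : ∀ k → All (suc k ≤_) ks × All (suc k ≤_) ls
  bound zero    = ks≥1 , ls≥1
  bound (suc k) = let k≤ks , k≤ls = bound k in
    raiseBound (s≤s z≤n) ks#ls e k≤ks k≤ls ,
    raiseBound (s≤s z≤n) (λ (x , y) → ks#ls (y , x)) (≋-sym e) k≤ls k≤ks

1-qProduct-injective : All (1 ≤_) ks → All (1 ≤_) ls → 1-qProduct ks ≋ 1-qProduct ls → ks ↭ ls
1-qProduct-injective {ks} {ls} ks≥1 ls≥1 e =
  ↭-trans C.ks↭ (↭-trans (↭-reflexive ks′≡ls′) (↭-sym C.ls↭))
  where
  module C = Cancellation (cancel ks ls)
  open ≋-Reasoning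
  ks′c = Allₚ.++⁻ C.ks′ (All-resp-↭ C.ks↭ ks≥1)
  ls′c = Allₚ.++⁻ C.ls′ (All-resp-↭ C.ls↭ ls≥1)
  both : C.ks′ ≡ [] × C.ls′ ≡ []
  both = 1-qProduct-disjoint (proj₁ ks′c) (proj₁ ls′c) C.disjoint
    (*-cancelʳ (1-qProduct C.common) (unitConstant-1-qProduct (proj₂ ks′c)) (begin
      1-qProduct C.ks′ * 1-qProduct C.common  ≈⟨ 1-qProduct-++ C.ks′ C.common ⟨
      1-qProduct (C.ks′ ++ C.common)          ≈⟨ product-↭ (map⁺ 1-q^_ C.ks↭) ⟨
      1-qProduct ks                           ≈⟨ e ⟩
      1-qProduct ls                           ≈⟨ product-↭ (map⁺ 1-q^_ C.ls↭) ⟩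
      1-qProduct (C.ls′ ++ C.common)          ≈⟨ 1-qProduct-++ C.ls′ C.common ⟩
      1-qProduct C.ls′ * 1-qProduct C.common  ∎))
  ks′≡ls′ : C.ks′ ++ C.common ≡ C.ls′ ++ C.common
  ks′≡ls′ = cong (_++ C.common) (≡.trans (proj₁ both) (≡.sym (proj₂ both)))

1-qProduct-qProduct : ∀ ks → 1-qProduct ks ≋ qProduct ks * 1-qProduct (replicate (length ks) 1)
1-qProduct-qProduct [] = ≋-sym (*-identityˡ 1#)
1-qProduct-qProduct (k ∷ ks) = begin
  (1-q^ k) * 1-qProduct ks
    ≈⟨ *-cong (≋-sym ([]q*1-q k)) (1-qProduct-qProduct ks) ⟩
  ([ k ]q * (1-q^ 1)) * (qProduct ks * 1-qProduct (replicate (length ks) 1))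
    ≈⟨ solve 4 (λ x o y z → (x :* o) :* (y :* z) := (x :* y) :* (o :* z)) ≋-refl
         [ k ]q (1-q^ 1) (qProduct ks) (1-qProduct (replicate (length ks) 1)) ⟩
  ([ k ]q * qProduct ks) * ((1-q^ 1) * 1-qProduct (replicate (length ks) 1)) ∎
  where open ≋-Reasoning

-- [k]_q = (1 − q^k) / (1 − q), and padding with 1s makes the powers of 1 − q equal.
qProduct-injective : All (1 ≤_) ks → All (1 ≤_) ls → qProduct ks ≋ qProduct ls →
  ks ++ replicate (length ls) 1 ↭ ls ++ replicate (length ks) 1
qProduct-injective {ks} {ls} ks≥1 ls≥1 e = 1-qProduct-injective
  (Allₚ.++⁺ ks≥1 (Allₚ.replicate⁺ (length ls) (s≤s z≤n)))
  (Allₚ.++⁺ ls≥1 (Allₚ.replicate⁺ (length ks) (s≤s z≤n))) (begin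
    1-qProduct (ks ++ replicate (length ls) 1)
      ≈⟨ 1-qProduct-++ ks _ ⟩
    1-qProduct ks * L
      ≈⟨ *-congʳ (1-qProduct-qProduct ks) ⟩
    (qProduct ks * K) * L
      ≈⟨ *-congʳ (*-congʳ e) ⟩
    (qProduct ls * K) * L
      ≈⟨ solve 3 (λ x y z → (x :* y) :* z := (x :* z) :* y) ≋-refl (qProduct ls) K L ⟩
    (qProduct ls * L) * K
      ≈⟨ *-congʳ (1-qProduct-qProduct ls) ⟨
    1-qProduct ls * K
      ≈⟨ 1-qProduct-++ ls _ ⟨
    1-qProduct (ls ++ replicate (length ks) 1) ∎)
  where
  open ≋-Reasoning
  K = 1-qProduct (replicate (length ks) 1)
  L = 1-qProduct (replicate (length ls) 1)

occurrences-++ : ∀ k ks ls → occurrences k (ks ++ ls) ≡ occurrences k ks ℕ.+ occurrences k ls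
occurrences-++ k ks ls =
  ≡.trans (cong length (filter-++ (k ≟_) ks ls)) (length-++ (filter (k ≟_) ks))

-- The padding in `qProduct-injective` consists of 1s, so it is invisible to the count of any `k`
-- from 2 on.
qProduct-occurrences : ∀ {k} → 2 ≤ k → All (1 ≤_) ks → All (1 ≤_) ls → qProduct ks ≋ qProduct ls →
                       occurrences k ks ≡ occurrences k ls
qProduct-occurrences {ks} {ls} {k} k≥2 ks≥1 ls≥1 e = begin
  occurrences k ks
    ≡⟨ padded ks (length ls) ⟨
  occurrences k (ks ++ replicate (length ls) 1)
    ≡⟨ ↭-length (filter-↭ (k ≟_) (qProduct-injective ks≥1 ls≥1 e)) ⟩
  occurrences k (ls ++ replicate (length ks) 1)
    ≡⟨ padded ls (length ks) ⟩
  occurrences k ls ∎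
  where
  open ≡.≡-Reasoning
  padded : ∀ ks n → occurrences k (ks ++ replicate n 1) ≡ occurrences k ks
  padded ks n = begin
    occurrences k (ks ++ replicate n 1)
      ≡⟨ occurrences-++ k ks (replicate n 1) ⟩
    occurrences k ks ℕ.+ occurrences k (replicate n 1)
      ≡⟨ cong (λ js → occurrences k ks ℕ.+ length js) (filter-none (k ≟_)
           (Allₚ.replicate⁺ n λ { refl → contradiction k≥2 λ { (s≤s ()) } })) ⟩
    occurrences k ks ℕ.+ 0
      ≡⟨ ℕₚ.+-identityʳ _ ⟩
    occurrences k ks ∎

-- Realisation by trees

-- A stalk of `n` edges rising from the root, with the forest `ts` attached at its upper end.
grow : ℕ → List Tree → List Tree
grow zero    ts = ts
grow (suc n) ts = node (grow n ts) ∷ []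

edges-grow : ∀ n ts → edges′ (grow n ts) ≡ n ℕ.+ edges′ ts
edges-grow zero    ts = refl
edges-grow (suc n) ts = cong suc (≡.trans (ℕₚ.+-identityʳ _) (edges-grow n ts))

edges-++ : ∀ ts us → edges′ (ts ++ us) ≡ edges′ ts ℕ.+ edges′ us
edges-++ []             us = refl
edges-++ (node ws ∷ ts) us =
  cong suc (≡.trans (cong (edges′ ws ℕ.+_) (edges-++ ts us)) (≡.sym (ℕₚ.+-assoc (edges′ ws) _ _)))

hooks-++ : ∀ ts us → hooks′ (ts ++ us) ≡ hooks′ ts ++ hooks′ us
hooks-++ []             us = refl
hooks-++ (node ws ∷ ts) us = cong (suc (edges′ ws) ∷_)
  (≡.trans (cong (hooks′ ws ++_) (hooks-++ ts us)) (≡.sym (++-assoc (hooks′ ws) _ _)))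

-- Each new bottom edge adds one hook equal to the new number of edges, exactly the factor by which
-- the q-factorial grows.
Q-grow : ∀ n ts → Q (node (grow n ts)) ≋ Q (node ts)
Q-grow zero    ts = ≋-refl
Q-grow (suc n) ts = ≋-trans (Q-plant (grow n ts)) (Q-grow n ts)
  where
  open ≋-Reasoning
  Q-plant : ∀ us → Q (node (node us ∷ [])) ≋ Q (node us)
  Q-plant us = *-cancelʳ (hookProduct (node us ∷ []))
    (unitConstant-qProduct (hooks≥1 (node us ∷ []))) (begin
      Q (node (node us ∷ [])) * hookProduct (node us ∷ [])
        ≈⟨ hookFormula (node (node us ∷ [])) ⟩
      [ suc (edges′ us ℕ.+ 0) ]q!
        ≡⟨ cong (λ n → [ suc n ]q!) (ℕₚ.+-identityʳ (edges′ us)) ⟩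
      [ suc (edges′ us) ]q * [ edges′ us ]q!
        ≈⟨ *-congˡ [ suc (edges′ us) ]q (hookFormula (node us)) ⟨
      [ suc (edges′ us) ]q * (Q (node us) * hookProduct us)
        ≈⟨ solve 3 (λ k x h → k :* (x :* h) := x :* (k :* (h :* con 1))) ≋-refl
             [ suc (edges′ us) ]q (Q (node us)) (hookProduct us) ⟩
      Q (node us) * ([ suc (edges′ us) ]q * (hookProduct us * 1#))
        ≈⟨ *-congˡ (Q (node us)) (hookProduct-∷ us []) ⟨
      Q (node us) * hookProduct (node us ∷ []) ∎)

-- The root has no hook, so gluing two trees at their roots just concatenates the hook lists. Only
-- the factorial changes, and `Q` acquires the q-binomial coefficient of the two edge numbers.
Q-++ : ∀ ts us → Q (node (ts ++ us)) * ([ edges′ ts ]q! * [ edges′ us ]q!) ≋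
                 [ edges′ ts ℕ.+ edges′ us ]q! * (Q (node ts) * Q (node us))
Q-++ ts us = begin
  Q (node (ts ++ us)) * ([ edges′ ts ]q! * [ edges′ us ]q!)
    ≈⟨ *-congˡ (Q (node (ts ++ us))) (*-cong (hookFormula (node ts)) (hookFormula (node us))) ⟨
  Q (node (ts ++ us)) * ((Q (node ts) * hookProduct ts) * (Q (node us) * hookProduct us))
    ≈⟨ solve 5 (λ w x h y j → w :* ((x :* h) :* (y :* j)) := (w :* (h :* j)) :* (x :* y)) ≋-refl
         (Q (node (ts ++ us))) (Q (node ts)) (hookProduct ts) (Q (node us)) (hookProduct us) ⟩
  (Q (node (ts ++ us)) * (hookProduct ts * hookProduct us)) * (Q (node ts) * Q (node us))
    ≈⟨ *-congʳ (*-congˡ (Q (node (ts ++ us))) (qProduct-++ (hooks′ ts) (hooks′ us))) ⟨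
  (Q (node (ts ++ us)) * qProduct (hooks′ ts ++ hooks′ us)) * (Q (node ts) * Q (node us))
    ≡⟨ cong (λ ks → (Q (node (ts ++ us)) * qProduct ks) * (Q (node ts) * Q (node us)))
         (hooks-++ ts us) ⟨
  (Q (node (ts ++ us)) * hookProduct (ts ++ us)) * (Q (node ts) * Q (node us))
    ≈⟨ *-congʳ (hookFormula (node (ts ++ us))) ⟩
  [ edges′ (ts ++ us) ]q! * (Q (node ts) * Q (node us))
    ≡⟨ cong (λ n → [ n ]q! * (Q (node ts) * Q (node us))) (edges-++ ts us) ⟩
  [ edges′ ts ℕ.+ edges′ us ]q! * (Q (node ts) * Q (node us)) ∎
  where open ≋-Reasoning

-- Products of q-binomial coefficients as lists of pairs

top : ℕ × ℕ → ℕ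
top = uncurry ℕ._+_

parts : List (ℕ × ℕ) → List ℕ
parts xs = map proj₁ xs ++ map proj₂ xs

factorials : List ℕ → Poly
factorials ks = product (map [_]q! ks)

parts-∷ : ∀ m n xs → parts ((m , n) ∷ xs) ↭ m ∷ n ∷ parts xs
parts-∷ m n xs = ↭-prep m (shift n (map proj₁ xs) (map proj₂ xs))

parts-↭ : ∀ {xs ys} → xs ↭ ys → parts xs ↭ parts ys
parts-↭ σ = ++⁺ (map⁺ proj₁ σ) (map⁺ proj₂ σ)

factorials-↭ : ks ↭ ls → factorials ks ≋ factorials ls
factorials-↭ σ = product-↭ (map⁺ [_]q! σ)

factorials-parts-∷ : ∀ m n xs →
  factorials (parts ((m , n) ∷ xs)) ≋ ([ m ]q! * [ n ]q!) * factorials (parts xs)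
factorials-parts-∷ m n xs =
  ≋-trans (factorials-↭ (parts-∷ m n xs)) (≋-sym (*-assoc [ m ]q! [ n ]q! _))

unitConstant-factorials : ∀ ks → HasUnitConstant (factorials ks)
unitConstant-factorials ks = unitConstant-product (Allₚ.map⁺ (All.universal unitConstant-! ks))

-- A pair (m , n) stands for the q-binomial coefficient [m + n]! / ([m]! [n]!).
IsQBinomialProduct : Poly → List (ℕ × ℕ) → Set
IsQBinomialProduct p xs = p * factorials (parts xs) ≋ factorials (map top xs)

-- S lists the lengths of the paths that are still available: the i-th tree is to replace the
-- i-th path, hence the prescribed numbers of edges.
Realisation : List (ℕ × ℕ) → List ℕ → Set
Realisation xs S = ∃ λ Ts → map edges Ts ≡ S × IsQBinomialProduct (product (map Q Ts)) xs

realisation-[] : ∀ S → Realisation [] S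
realisation-[] []      = [] , refl , *-identityˡ 1#
realisation-[] (s ∷ S) with Ts , eq , e ← realisation-[] S =
  node (grow s []) ∷ Ts ,
  cong₂ _∷_ (≡.trans (edges-grow s []) (ℕₚ.+-identityʳ s)) eq ,
  ≋-trans (*-congʳ (≋-trans (*-congʳ (Q-grow s [])) (*-identityˡ (product (map Q Ts))))) e

-- The trees realised in the slots `m` and `n` are glued at their roots, which contributes the new
-- q-binomial coefficient, and raised on a stalk to reach `s` edges, which leaves `Q` unchanged.
-- Pairs chosen earlier thus lie nearer the root.
realisation-∷ : ∀ {xs S} m n s → m ℕ.+ n ≤ s → Realisation xs (m ∷ n ∷ S) →
                Realisation ((m , n) ∷ xs) (s ∷ S)
realisation-∷ {xs} _ _ s m+n≤s (T@(node ts) ∷ U@(node us) ∷ Ts , refl , e) =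
  node (grow k (ts ++ us)) ∷ Ts , cong (_∷ map edges Ts) size , (begin
    (Q (node (grow k (ts ++ us))) * R) * factorials (parts ((edges T , edges U) ∷ xs))
      ≈⟨ *-cong (*-congʳ (Q-grow k (ts ++ us))) (factorials-parts-∷ (edges T) (edges U) xs) ⟩
    (W * R) * (F * G)
      ≈⟨ solve 4 (λ w r f g → (w :* r) :* (f :* g) := (w :* f) :* (r :* g)) ≋-refl W R F G ⟩
    (W * F) * (R * G)
      ≈⟨ *-congʳ (Q-++ ts us) ⟩
    ([ edges T ℕ.+ edges U ]q! * (Q T * Q U)) * (R * G)
      ≈⟨ solve 5 (λ f x y r g → (f :* (x :* y)) :* (r :* g) := f :* ((x :* (y :* r)) :* g)) ≋-refl
           [ edges T ℕ.+ edges U ]q! (Q T) (Q U) R G ⟩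
    [ edges T ℕ.+ edges U ]q! * ((Q T * (Q U * R)) * G)
      ≈⟨ *-congˡ [ edges T ℕ.+ edges U ]q! e ⟩
    [ edges T ℕ.+ edges U ]q! * factorials (map top xs) ∎)
  where
  open ≋-Reasoning
  k = s ∸ (edges T ℕ.+ edges U)
  R = product (map Q Ts)
  W = Q (node (ts ++ us))
  F = [ edges T ]q! * [ edges U ]q!
  G = factorials (parts xs)
  size : edges′ (grow k (ts ++ us)) ≡ s
  size = ≡.trans (edges-grow k (ts ++ us))
    (≡.trans (cong (k ℕ.+_) (edges-++ ts us)) (ℕₚ.m∸n+n≡m m+n≤s))

realisation-resp-↭ : ∀ {xs ys S S′} → xs ↭ ys → S ↭ S′ → Realisation xs S → Realisation ys S′
realisation-resp-↭ {xs} {ys} σ τ (Ts , refl , e) with Us , eq , υ ← ↭-map-inv edges τ =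
  Us , ≡.sym eq , (begin
    product (map Q Us) * factorials (parts ys)
      ≈⟨ *-cong (product-↭ (map⁺ Q υ)) (factorials-↭ (parts-↭ σ)) ⟨
    product (map Q Ts) * factorials (parts xs)  ≈⟨ e ⟩
    factorials (map top xs)                     ≈⟨ factorials-↭ (map⁺ top σ) ⟩
    factorials (map top ys)                     ∎)
  where open ≋-Reasoning

-- The counting condition on available paths

countAtLeast : ℕ → List ℕ → ℕ
countAtLeast k ks = length (filter (k ≤?_) ks)

countAtLeast-↭ : ∀ k → ks ↭ ls → countAtLeast k ks ≡ countAtLeast k ls
countAtLeast-↭ k σ = ↭-length (filter-↭ (k ≤?_) σ)

countAtLeast-accept : ∀ {k l} ks → k ≤ l → countAtLeast k (l ∷ ks) ≡ suc (countAtLeast k ks)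
countAtLeast-accept {k} ks k≤l = cong length (filter-accept (k ≤?_) k≤l)

countAtLeast-none : ∀ {k} → All (_< k) ks → countAtLeast k ks ≡ 0
countAtLeast-none {k = k} ks<k = cong length (filter-none (k ≤?_) (All.map ℕₚ.<⇒≱ ks<k))

countAtLeast-some : ∀ {k} ks → 0 < countAtLeast k ks → Any (k ≤_) ks
countAtLeast-some {k} (l ∷ ks) h with k ≤? l
... | yes k≤l = here k≤l
... | no  k≰l = there (countAtLeast-some ks
  (≡.subst (0 <_) (cong length (filter-reject (k ≤?_) k≰l)) h))

-- When no top exceeds N = m + n, the parts are all smaller than N, so this condition at k = N
-- provides an element of S that is at least N.
Capacity : List (ℕ × ℕ) → List ℕ → Set
Capacity xs S = ∀ k → 2 ≤ k → countAtLeast k (map top xs) ≤ countAtLeast k (parts xs ++ S)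

Positive : ℕ × ℕ → Set
Positive (m , n) = 1 ≤ m × 1 ≤ n

extractMaximum : ∀ {A : Set} (f : A → ℕ) x xs →
  ∃ λ y → ∃ λ ys → (x ∷ xs ↭ y ∷ ys) × All (λ z → f z ≤ f y) ys
extractMaximum f x [] = x , [] , ↭-refl , []
extractMaximum f x (x′ ∷ xs) with y , ys , σ , ys≤y ← extractMaximum f x′ xs | ℕₚ.≤-total (f x) (f y)
... | inj₁ x≤y = y , x ∷ ys , ↭-trans (↭-prep x σ) (↭-swap x y ↭-refl) , x≤y ∷ ys≤y
... | inj₂ y≤x = x , y ∷ ys , ↭-prep x σ , y≤x ∷ All.map (λ z≤y → ℕₚ.≤-trans z≤y y≤x) ys≤y

-- Positivity of the other part makes each part strictly smaller than its top; this strictness is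
-- what excludes the parts in `slot`.
parts<top : ∀ {N xs} → All Positive xs → All (λ x → top x ≤ N) xs → All (_< N) (parts xs)
parts<top {N} xs>0 xs≤N = Allₚ.++⁺ (Allₚ.map⁺ (All.zipWith first< (xs>0 , xs≤N)))
                                   (Allₚ.map⁺ (All.zipWith second< (xs>0 , xs≤N)))
  where
  first< : ∀ {x} → Positive x × top x ≤ N → proj₁ x < N
  first< {m , n} ((_ , n>0) , m+n≤N) = ℕₚ.<-≤-trans (ℕₚ.m<m+n m n>0) m+n≤N
  second< : ∀ {x} → Positive x × top x ≤ N → proj₂ x < N
  second< {m , n} ((m>0 , _) , m+n≤N) = ℕₚ.<-≤-trans (ℕₚ.m<n+m n m>0) m+n≤N

slot : ∀ {x xs S} → All Positive (x ∷ xs) → All (λ z → top z ≤ top x) xs →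
       Capacity (x ∷ xs) S → ∃ λ s → ∃ λ S′ → top x ≤ s × S ↭ s ∷ S′
slot {x@(m , n)} {xs} {S} xs>0@((m>0 , n>0) ∷ _) xs≤x capacity
  with Anyₚ.++⁻ (parts (x ∷ xs)) (countAtLeast-some (parts (x ∷ xs) ++ S) (begin-strict
    0                                    <⟨ s≤s z≤n ⟩
    suc (countAtLeast (top x) (map top xs)) ≡⟨ countAtLeast-accept (map top xs) ℕₚ.≤-refl ⟨
    -- The condition is available at `top x` because two positive parts add up to at least 2.
    countAtLeast (top x) (map top (x ∷ xs)) ≤⟨ capacity (top x) (ℕₚ.+-mono-≤ m>0 n>0) ⟩
    countAtLeast (top x) (parts (x ∷ xs) ++ S) ∎))
  where open ℕₚ.≤-Reasoning
... | inj₁ i = contradiction i (Allₚ.All¬⇒¬Any (All.map ℕₚ.<⇒≱ (parts<top xs>0 (ℕₚ.≤-refl ∷ xs≤x))))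
... | inj₂ i with s , s∈S , x≤s ← find i with S′ , σ ← ∈⇒↭ s∈S = s , S′ , x≤s , σ

-- For k ≤ m + n, both counts drop by one: the left loses the top m + n, the right loses `s`, while
-- `m` and `n` merely move from the parts to the available paths. For larger k, no top counts at
-- all, by maximality of m + n.
capacity-∷ : ∀ {m n xs s S S′} → All (λ z → top z ≤ m ℕ.+ n) xs → m ℕ.+ n ≤ s → S ↭ s ∷ S′ →
  Capacity ((m , n) ∷ xs) S → Capacity xs (m ∷ n ∷ S′)
capacity-∷ {m} {n} {xs} {s} {S} {S′} xs≤x x≤s σ capacity k k≥2 with k ≤? m ℕ.+ n
... | yes k≤x = ℕ.s≤s⁻¹ (begin
  suc (countAtLeast k (map top xs))               ≡⟨ countAtLeast-accept (map top xs) k≤x ⟨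
  countAtLeast k (map top ((m , n) ∷ xs))         ≤⟨ capacity k k≥2 ⟩
  countAtLeast k (parts ((m , n) ∷ xs) ++ S)      ≡⟨ countAtLeast-↭ k τ ⟩
  countAtLeast k (s ∷ parts xs ++ m ∷ n ∷ S′)
    ≡⟨ countAtLeast-accept (parts xs ++ m ∷ n ∷ S′) (ℕₚ.≤-trans k≤x x≤s) ⟩
  suc (countAtLeast k (parts xs ++ m ∷ n ∷ S′))   ∎)
  where
  open ℕₚ.≤-Reasoning
  τ : parts ((m , n) ∷ xs) ++ S ↭ s ∷ parts xs ++ m ∷ n ∷ S′
  τ = ↭-trans (++⁺ (parts-∷ m n xs) σ) (↭-trans (shift s (m ∷ n ∷ parts xs) S′)
        (↭-prep s (shifts (m ∷ n ∷ []) (parts xs))))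
... | no k≰x = ℕₚ.≤-trans (ℕₚ.≤-reflexive (countAtLeast-none
  (Allₚ.map⁺ (All.map (λ z≤x → ℕₚ.≤-<-trans z≤x (ℕₚ.≰⇒> k≰x)) xs≤x)))) z≤n

capacity-resp-↭ : ∀ {xs ys S} → xs ↭ ys → Capacity xs S → Capacity ys S
capacity-resp-↭ {xs} {ys} {S} σ capacity k k≥2 = begin
  countAtLeast k (map top ys)    ≡⟨ countAtLeast-↭ k (map⁺ top σ) ⟨
  countAtLeast k (map top xs)    ≤⟨ capacity k k≥2 ⟩
  countAtLeast k (parts xs ++ S) ≡⟨ countAtLeast-↭ k (++⁺ʳ S (parts-↭ σ)) ⟩
  countAtLeast k (parts ys ++ S) ∎
  where open ℕₚ.≤-Reasoning

-- Pairs are treated in order of decreasing top, since `slot` and `capacity-∷` both need the current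
-- one to be maximal. Recursion is on the length because extracting the maximum may reorder the
-- list.
realise : ∀ xs S → All Positive xs → Capacity xs S → Realisation xs S
realise xs = byLength (length xs) xs refl
  where
  byLength : ∀ l xs → length xs ≡ l → ∀ S → All Positive xs → Capacity xs S → Realisation xs S
  byLength zero    []       _  S _    _ = realisation-[] S
  byLength (suc l) (x ∷ xs) eq S xs>0 capacity
    with (m , n) , ys , σ , ys≤y ← extractMaximum top x xs
    with _ ∷ ys>0 ← All-resp-↭ σ xs>0
    with capacity′ ← capacity-resp-↭ σ capacity
    with s , S′ , y≤s , τ ← slot (All-resp-↭ σ xs>0) ys≤y capacity′
    = realisation-resp-↭ (↭-sym σ) (↭-sym τ) (realisation-∷ {ys} m n s y≤s
        (byLength l ys (ℕₚ.suc-injective (≡.trans (≡.sym (↭-length σ)) eq)) (m ∷ n ∷ S′) ys>0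
          (capacity-∷ ys≤y y≤s τ capacity′)))

-- From a repetition-free numerator to the counting condition

ranges : List ℕ → List ℕ
ranges = concatMap range

qProduct-ranges : ∀ ks → qProduct (ranges ks) ≋ factorials ks
qProduct-ranges []       = ≋-refl
qProduct-ranges (k ∷ ks) = ≋-trans (qProduct-++ (range k) (ranges ks))
  (*-cong (reflexive (qProduct-range k)) (qProduct-ranges ks))

ranges≥1 : ∀ ks → All (1 ≤_) (ranges ks)
ranges≥1 ks = Allₚ.concat⁺ (Allₚ.map⁺ (All.universal range≥1 ks))

occurrences-< : ∀ {k} n → n < k → occurrences k (range n) ≡ 0
occurrences-< {k} n n<k = cong length (filter-none (k ≟_)
  (Allₚ.applyDownFrom⁺₁ suc n λ { i<n refl → ℕₚ.<⇒≱ n<k i<n }))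

occurrences-≤ : ∀ {k} n → 1 ≤ k → k ≤ n → occurrences k (range n) ≡ 1
occurrences-≤ {k}     zero    k≥1 k≤0 = contradiction (ℕₚ.≤-trans k≥1 k≤0) λ ()
occurrences-≤ {k} (suc n) k≥1 k≤n with k ≟ suc n
... | yes refl = ≡.trans (cong length (filter-accept (k ≟_) refl)) (cong suc (occurrences-< n ℕₚ.≤-refl))
... | no  k≢n  = ≡.trans (cong length (filter-reject (k ≟_) k≢n))
                         (occurrences-≤ n k≥1 (ℕₚ.≤-pred (ℕₚ.≤∧≢⇒< k≤n k≢n)))

-- The factorial `[ l ]q!` contains `[ k ]q` once if k ≤ l and not at all otherwise. This turns
-- multiplicities of q-integers into the counts used by `Capacity`.
occurrences-ranges : ∀ {k} → 1 ≤ k → ∀ ks → occurrences k (ranges ks) ≡ countAtLeast k ks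
occurrences-ranges {k} k≥1 []       = refl
occurrences-ranges {k} k≥1 (l ∷ ks) = ≡.trans (occurrences-++ k (range l) (ranges ks))
  (case k ≤? l of λ where
    (yes k≤l) → ≡.trans (cong₂ ℕ._+_ (occurrences-≤ l k≥1 k≤l) (occurrences-ranges k≥1 ks))
                        (≡.sym (countAtLeast-accept ks k≤l))
    (no  k≰l) → ≡.trans (cong₂ ℕ._+_ (occurrences-< l (ℕₚ.≰⇒> k≰l)) (occurrences-ranges k≥1 ks))
                        (≡.sym (cong length (filter-reject (k ≤?_) k≰l))))

Unique⇒occurrences≤1 : ∀ k → Unique ks → occurrences k ks ≤ 1
Unique⇒occurrences≤1 k [] = z≤n
Unique⇒occurrences≤1 {l ∷ ks} k (l∉ks ∷ ks!) = case k ≟ l of λ where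
  (yes refl) → ℕₚ.≤-reflexive (≡.trans (cong length (filter-accept (k ≟_) refl))
                 (cong (suc ∘ length) (filter-none (k ≟_) l∉ks)))
  (no  k≢l)  → ℕₚ.≤-trans (ℕₚ.≤-reflexive (cong length (filter-reject (k ≟_) k≢l)))
                 (Unique⇒occurrences≤1 k ks!)

-- Clearing denominators equates the reduced numerator times the factorials of the parts with the
-- reduced denominator times the factorials of the tops. Comparing the multiplicity of `[ k ]q`, the
-- tops exceed the parts by at most its multiplicity in the numerator, hence by at most 1.
nonRepeating⇒capacity : ∀ {p xs} → IsQBinomialProduct p xs → NumeratorDoesNotRepeat p →
                        Capacity xs (max 0 (map top xs) ∷ [])
nonRepeating⇒capacity {p} {xs} e (as , bs , reduced , as!) k k≥2 = case k ≤? M of λ where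
    (no  k≰M) → ℕₚ.≤-trans (ℕₚ.≤-reflexive (countAtLeast-none
      (All.map (λ x≤M → ℕₚ.≤-<-trans x≤M (ℕₚ.≰⇒> k≰M)) (xs≤max 0 (map top xs))))) z≤n
    (yes k≤M) → begin
      countAtLeast k (map top xs)
        ≡⟨ occurrences-ranges k≥1 (map top xs) ⟨
      occurrences k (ranges (map top xs))
        ≤⟨ ℕₚ.m≤n+m _ (occurrences k bs) ⟩
      occurrences k bs ℕ.+ occurrences k (ranges (map top xs))
        ≡⟨ occurrences-++ k bs _ ⟨
      occurrences k (bs ++ ranges (map top xs))
        ≡⟨ sameOccurrences ⟨
      occurrences k (as ++ ranges (parts xs))
        ≡⟨ occurrences-++ k as _ ⟩
      occurrences k as ℕ.+ occurrences k (ranges (parts xs))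
        ≤⟨ ℕₚ.+-monoˡ-≤ _ (Unique⇒occurrences≤1 k as!) ⟩
      1 ℕ.+ occurrences k (ranges (parts xs))
        ≡⟨ cong suc (occurrences-ranges k≥1 (parts xs)) ⟩
      1 ℕ.+ countAtLeast k (parts xs)
        -- The one extra occurrence that the numerator allows is accounted for by the initial path
        -- of length `M`.
        ≡⟨ countAtLeast-accept (parts xs) k≤M ⟨
      countAtLeast k (M ∷ parts xs)
        ≡⟨ countAtLeast-↭ k (++-comm (M ∷ []) (parts xs)) ⟩
      countAtLeast k (parts xs ++ M ∷ []) ∎
  where
  open ℕₚ.≤-Reasoning
  open IsReducedForm reduced
  -- The default 0 covers the empty product, realised by a single vertex.
  M = max 0 (map top xs)
  k≥1 : 1 ≤ k
  k≥1 = ℕₚ.≤-trans (s≤s z≤n) k≥2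
  2≤⇒1≤ : ∀ {l} → 2 ≤ l → 1 ≤ l
  2≤⇒1≤ = ℕₚ.≤-trans (s≤s z≤n)
  sameProduct : qProduct (as ++ ranges (parts xs)) ≋ qProduct (bs ++ ranges (map top xs))
  sameProduct = SR.begin
    qProduct (as ++ ranges (parts xs))
      SR.≈⟨ qProduct-++ as _ ⟩
    qProduct as * qProduct (ranges (parts xs))
      SR.≈⟨ *-cong (≋-sym (coeffwise {p * qProduct bs} {qProduct as} quotient))
                   (qProduct-ranges (parts xs)) ⟩
    (p * qProduct bs) * factorials (parts xs)
      SR.≈⟨ solve 3 (λ x y z → (x :* y) :* z := y :* (x :* z)) ≋-refl
              p (qProduct bs) (factorials (parts xs)) ⟩
    qProduct bs * (p * factorials (parts xs))
      SR.≈⟨ *-congˡ (qProduct bs) (≋-trans e (≋-sym (qProduct-ranges (map top xs)))) ⟩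
    qProduct bs * qProduct (ranges (map top xs))
      SR.≈⟨ qProduct-++ bs _ ⟨
    qProduct (bs ++ ranges (map top xs)) SR.∎
    where module SR = ≋-Reasoning
  sameOccurrences : occurrences k (as ++ ranges (parts xs)) ≡ occurrences k (bs ++ ranges (map top xs))
  sameOccurrences = qProduct-occurrences k≥2
    (Allₚ.++⁺ (All.map 2≤⇒1≤ as≥2) (ranges≥1 (parts xs)))
    (Allₚ.++⁺ (All.map 2≤⇒1≤ bs≥2) (ranges≥1 (map top xs))) sameProduct

nonRepeating⇒Q : ∀ {p} xs → All Positive xs → IsQBinomialProduct p xs → NumeratorDoesNotRepeat p →
                 ∃ λ T → Q T ≋ p
nonRepeating⇒Q {p} xs xs>0 e nonRepeating
  -- Starting from a single path, the realisation consists of exactly one tree.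
  with T ∷ [] , _ , f ← realise xs (max 0 (map top xs) ∷ []) xs>0
                          (nonRepeating⇒capacity {p} {xs} e nonRepeating)
  = T , *-cancelʳ (factorials (parts xs)) (unitConstant-factorials (parts xs)) (begin
      Q T * factorials (parts xs)         ≈⟨ *-congʳ (*-identityʳ (Q T)) ⟨
      (Q T * 1#) * factorials (parts xs)  ≈⟨ f ⟩
      factorials (map top xs)             ≈⟨ e ⟨
      p * factorials (parts xs)           ∎)
  where open ≋-Reasoning

isQBinomialProduct : ∀ k (m n : Fin k → ℕ) (P : Fin k → Poly) →
  (∀ i → IsQBinomial (m i) (n i) (P i)) →
  IsQBinomialProduct (product (tabulate P)) (tabulate λ i → m i , n i)
isQBinomialProduct zero    m n P e = *-identityˡ 1#
isQBinomialProduct (suc k) m n P e = begin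
  (A * B) * factorials (parts ((m₀ , n₀) ∷ xs))
    ≈⟨ *-congˡ (A * B) (factorials-parts-∷ m₀ n₀ xs) ⟩
  (A * B) * (([ m₀ ]q! * [ n₀ ]q!) * factorials (parts xs))
    ≈⟨ solve 4 (λ x y z w → (x :* y) :* (z :* w) := (x :* z) :* (y :* w)) ≋-refl
         A B ([ m₀ ]q! * [ n₀ ]q!) (factorials (parts xs)) ⟩
  (A * ([ m₀ ]q! * [ n₀ ]q!)) * (B * factorials (parts xs))
    ≈⟨ *-cong (coeffwise {A * ([ m₀ ]q! * [ n₀ ]q!)} {[ m₀ ℕ.+ n₀ ]q!} (e Fin.zero))
         (isQBinomialProduct k (m ∘ Fin.suc) (n ∘ Fin.suc) (P ∘ Fin.suc) (e ∘ Fin.suc)) ⟩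
  [ m₀ ℕ.+ n₀ ]q! * factorials (map top xs) ∎
  where
  open ≋-Reasoning
  m₀ = m Fin.zero
  n₀ = n Fin.zero
  A = P Fin.zero
  B = product (tabulate (P ∘ Fin.suc))
  xs = tabulate λ i → m (Fin.suc i) , n (Fin.suc i)

theorem5p6 : (k : ℕ) (m n : Fin k → ℕ) →
    (∀ i → 1 ≤ m i) → (∀ i → 1 ≤ n i) →
    (P : Fin k → Poly) → (∀ i → IsQBinomial (m i) (n i) (P i)) →
    (∃ λ T → Q T ≈ product (tabulate P)) ⇔ NumeratorDoesNotRepeat (product (tabulate P))
theorem5p6 k m n m≥1 n≥1 P e = mk⇔
  (λ (T , f) → Q-numeratorDoesNotRepeat T (coeffwise f))
  (λ h → let T , f = nonRepeating⇒Q (tabulate λ i → m i , n i)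
                       (Allₚ.tabulate⁺ λ i → m≥1 i , n≥1 i)
                       (isQBinomialProduct k m n P e) h
         in T , at f)
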